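{- Let $n$ be a positive integer and $i\in\{1,2\}$. Then $r(P_n,T_n^i)=2n-7$ for $n\ge 17$, $r(P_{n-1},T_n^i)=2n-7$ for $n\ge 13$, $r(P_{n-2},T_n^i)=2n-7$ for $n\ge 11$, and $r(P_{n-3},T_n^i)=2n-7$ for $n\ge 8$.
   Context: All graphs are finite and simple. $P_m$ is the path on $m$ vertices. For graphs $G_1,G_2$, the Ramsey number $r(G_1,G_2)$ is the smallest positive integer $N$ such that for every graph $G$ on $N$ vertices, either $G$ contains a subgraph isomorphic to $G_1$ or the complement $\overline G$ contains a subgraph isomorphic to $G_2$. $T_n^1$ is the tree with vertex set $\{v_0,\ldots,v_{n-1}\}$ and edge set $\{v_0v_1,\ldots,v_0v_{n-3},v_{n-4}v_{n-2},v_{n-3}v_{n-1}\}$; $T_n^2$ is the tree with the same vertex set and edge set $\{v_0v_1,\ldots,v_0v_{n-3},v_{n-3}v_{n-2},v_{n-3}v_{n-1}\}$. -}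

module Defs where

open import Data.Bool using (Bool; true; false; _∨_; _∧_; not)
open import Data.Nat using (ℕ; zero; suc; _∸_; _≤_; _<_; _≡ᵇ_; _≤ᵇ_)
open import Data.Fin as Fin using (Fin; toℕ)
open import Data.Product using (Σ; _×_)
open import Data.Sum using (_⊎_)
open import Relation.Nullary using (¬_)
open import Relation.Binary.PropositionalEquality using (_≡_)
open import Function.Definitions using (Injective)

record Graph (N : ℕ) : Set where
  field
    adj    : Fin N → Fin N → Bool
    sym    : ∀ u v → adj u v ≡ adj v u
    irrefl : ∀ u → adj u u ≡ false
open Graph public using (adj)

complement : ∀ {N} → Graph N → Graph N
complement {N} G = record { adj = a ; sym = s ; irrefl = i }
  where
  open import Data.Fin using (_≟_)
  open import Relation.Nullary using (yes; no)
  open import Relation.Binary.PropositionalEquality using (refl; cong; sym)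
  a : Fin N → Fin N → Bool
  a u v with u ≟ v
  ... | yes _ = false
  ... | no  _ = not (Graph.adj G u v)
  s : ∀ u v → a u v ≡ a v u
  s u v with u ≟ v | v ≟ u
  ... | yes _ | yes _ = refl
  ... | yes p | no q = Data.Empty.⊥-elim (q (sym p)) where import Data.Empty
  ... | no p | yes q = Data.Empty.⊥-elim (p (sym q)) where import Data.Empty
  ... | no _ | no _ = cong not (Graph.sym G u v)
  i : ∀ u → a u u ≡ false
  i u with u ≟ u
  ... | yes _ = refl
  ... | no p = Data.Empty.⊥-elim (p refl) where import Data.Empty

Contains : ∀ {N m} → Graph N → Graph m → Set
Contains {N} {m} G H =
  Σ (Fin m → Fin N) λ f →
    Injective _≡_ _≡_ f ×
    (∀ i j → adj H i j ≡ true → adj G (f i) (f j) ≡ true)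

RamseyProp : ∀ {m k} → Graph m → Graph k → ℕ → Set
RamseyProp G1 G2 N = ∀ (G : Graph N) → Contains G G1 ⊎ Contains (complement G) G2

RamseyNumberIs : ∀ {m k} → Graph m → Graph k → ℕ → Set
RamseyNumberIs G1 G2 N =
  1 ≤ N × RamseyProp G1 G2 N × (∀ M → 1 ≤ M → M < N → ¬ RamseyProp G1 G2 M)

symClose : (m : ℕ) → (Fin m → Fin m → Bool) → Graph m
symClose m R = record { adj = a ; sym = s ; irrefl = i }
  where
  open import Data.Fin using (_≟_)
  open import Data.Bool.Properties using (∨-comm)
  open import Relation.Nullary using (yes; no)
  open import Relation.Binary.PropositionalEquality using (refl; sym)
  open import Data.Empty using (⊥-elim)
  a : Fin m → Fin m → Bool
  a u v with u ≟ v
  ... | yes _ = false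
  ... | no  _ = R u v ∨ R v u
  s : ∀ u v → a u v ≡ a v u
  s u v with u ≟ v | v ≟ u
  ... | yes _ | yes _ = refl
  ... | yes p | no q = ⊥-elim (q (sym p))
  ... | no p | yes q = ⊥-elim (p (sym q))
  ... | no _ | no _ = ∨-comm (R u v) (R v u)
  i : ∀ u → a u u ≡ false
  i u with u ≟ u
  ... | yes _ = refl
  ... | no p = ⊥-elim (p refl)

fromEdges : (m : ℕ) → (ℕ → ℕ → Bool) → Graph m
fromEdges m E = symClose m (λ u v → E (toℕ u) (toℕ v))

Path : (m : ℕ) → Graph m
Path m = fromEdges m (λ a b → suc a ≡ᵇ b)

T1 : (n : ℕ) → Graph n
T1 n = fromEdges n E
  where
  E : ℕ → ℕ → Bool
  E a b = ((a ≡ᵇ 0) ∧ (1 ≤ᵇ b) ∧ (b ≤ᵇ n ∸ 3))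
        ∨ ((a ≡ᵇ n ∸ 4) ∧ (b ≡ᵇ n ∸ 2))
        ∨ ((a ≡ᵇ n ∸ 3) ∧ (b ≡ᵇ n ∸ 1))

T2 : (n : ℕ) → Graph n
T2 n = fromEdges n E
  where
  E : ℕ → ℕ → Bool
  E a b = ((a ≡ᵇ 0) ∧ (1 ≤ᵇ b) ∧ (b ≤ᵇ n ∸ 3))
        ∨ ((a ≡ᵇ n ∸ 3) ∧ (b ≡ᵇ n ∸ 2))
        ∨ ((a ≡ᵇ n ∸ 3) ∧ (b ≡ᵇ n ∸ 1))

T : Fin 2 → (n : ℕ) → Graph n
T Fin.zero n = T1 n
T (Fin.suc Fin.zero) n = T2 n

{-# OPTIONS --safe #-}
module Submission where

-- Lower bound: the disjoint union of two copies of K_{n-4} has no path on n - 3 vertices, and its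
-- complement has maximal degree at most n - 4, whereas T_n^i has a vertex of degree n - 3.
--
-- Upper bound: on 2n - 7 vertices there is even a path on 2n - 11 vertices, or T_n^i in the
-- complement. If all degrees of G are at least n - 4, then G has a Hamiltonian path by Dirac's
-- argument. Otherwise some v has a set A of n - 3 non-neighbours; let B be the other n - 5
-- vertices. As v is the centre of a star onto A in the complement, only two pendant edges from A
-- into B are missing for T_n^i. If they cannot be found, then, after dropping at most one vertex
-- of A, every vertex of A is joined in G to all but at most one vertex of B, and a longest path
-- alternating between A and B misses at most one vertex of B.

open import Defs
open import Data.Bool using (Bool; true; false; _∨_; _∧_; not)
open import Data.Bool.Properties using (T-∧; T-∨; T-≡)
open import Data.Nat
  using (ℕ; zero; suc; _+_; _∸_; _*_; _≤_; _<_; z≤n; s≤s; s≤s⁻¹; _≡ᵇ_; _≤ᵇ_; _<?_)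
open import Data.Nat.ListAction using (sum)
open import Data.Nat.ListAction.Properties using (sum-++; sum-↭)
open import Data.Nat.Properties
open import Data.Nat.Tactic.RingSolver using (solve-∀)
open import Data.Fin as Fin using (Fin; toℕ)
open import Data.Fin.Properties
  using (toℕ-injective; toℕ<n; toℕ-fromℕ<; fromℕ<-toℕ; toℕ-inject≤; inject≤-injective;
         combine-remQuot; injective⇒≤; any?)
  renaming (suc-injective to Fin-suc-injective)
open import Data.List
  using (List; []; _∷_; [_]; _++_; _∷ʳ_; _ʳ++_; length; map; take; drop; allFin)
open import Data.List.Properties
  using (length-++; map-++; ++-assoc; take++drop≡id; length-take; length-tabulate)
open import Data.List.Membership.Propositional using (_∈_)
open import Data.List.Membership.Propositional.Properties
  using (∈-∃++; ∈-++⁺ˡ; ∈-++⁺ʳ; ∈-allFin)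
open import Data.List.Relation.Binary.Permutation.Propositional
  using (_↭_; prep; swap; ↭⇒↭ₛ; ↭-refl; ↭-sym; ↭-trans; ↭-reflexive;
         module PermutationReasoning)
open import Data.List.Relation.Binary.Permutation.Propositional.Properties
  using (∈-resp-↭; All-resp-↭; ↭-length; ++⁺; ++⁺ˡ; ++⁺ʳ; ++-comm; shift; shifts; ++↭ʳ++; map⁺)
import Data.List.Relation.Binary.Permutation.Setoid.Properties as PermS
open import Data.List.Relation.Unary.All as All using (All; []; _∷_)
open import Data.List.Relation.Unary.All.Properties using (++⁻ˡ; take⁺)
open import Data.List.Relation.Unary.Any using (here; there)
open import Data.List.Relation.Unary.AllPairs using ([]; _∷_)
open import Data.List.Relation.Unary.Unique.Propositional using (Unique)
open import Data.List.Relation.Unary.Unique.Propositional.Properties using (allFin⁺)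
open import Data.Product using (∃₂; ∃-syntax; _×_; _,_)
open import Data.Sum using (_⊎_; inj₁; inj₂; [_,_]′; map₂)
open import Function using (_∘_; id; Equivalence)
open import Relation.Nullary using (yes; no; ¬_; contradiction)
open import Relation.Nullary.Decidable using (isYes; toWitness; fromWitness)
open import Relation.Binary.PropositionalEquality
  using (_≡_; _≢_; refl; sym; trans; cong; cong₂; subst; setoid; module ≡-Reasoning)

-- Picking from lists, counting and distinctness.

private variable
  A : Set
  P Q : A → Set

-- Both outcomes carry positive information, and a found element comes with the remaining `ys`,
-- since later arguments move vertices between lists up to permutation.
pick : (∀ x → P x ⊎ Q x) → ∀ xs → (∃₂ λ x ys → P x × xs ↭ x ∷ ys) ⊎ All Q xs
pick d [] = inj₂ []
pick d (x ∷ xs) with d x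
... | inj₁ p = inj₁ (x , xs , p , ↭-refl)
... | inj₂ q with pick d xs
...   | inj₂ qs = inj₂ (q ∷ qs)
...   | inj₁ (y , ys , p , σ) = inj₁ (y , x ∷ ys , p , ↭-trans (prep x σ) (swap x y ↭-refl))

∈⇒↭ : ∀ {x : A} {xs} → x ∈ xs → ∃[ ys ] xs ↭ x ∷ ys
∈⇒↭ x∈xs with ys , zs , refl ← ∈-∃++ x∈xs = ys ++ zs , shift _ ys zs

indicator : Bool → ℕ
indicator true  = 1
indicator false = 0

count : (A → Bool) → List A → ℕ
count p xs = sum (map (indicator ∘ p) xs)

count-↭ : ∀ (p : A → Bool) {xs ys} → xs ↭ ys → count p xs ≡ count p ys
count-↭ p σ = sum-↭ (map⁺ (indicator ∘ p) σ)

count-++ : ∀ (p : A → Bool) xs ys → count p (xs ++ ys) ≡ count p xs + count p ys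
count-++ p xs ys =
  trans (cong sum (map-++ (indicator ∘ p) xs ys)) (sum-++ (map (indicator ∘ p) xs) _)

count-all : ∀ (p : A → Bool) {xs} → All (λ x → p x ≡ true) xs → count p xs ≡ length xs
count-all p []         = refl
count-all p (eq ∷ eqs) rewrite eq = cong suc (count-all p eqs)

count-none : ∀ (p : A → Bool) {xs} → All (λ x → p x ≡ false) xs → count p xs ≡ 0
count-none p []         = refl
count-none p (eq ∷ eqs) rewrite eq = count-none p eqs

count≤length : ∀ (p : A → Bool) xs → count p xs ≤ length xs
count≤length p []       = z≤n
count≤length p (x ∷ xs) with p x
... | true  = s≤s (count≤length p xs)
... | false = m≤n⇒m≤1+n (count≤length p xs)

Unique-++⁻ˡ : ∀ (xs : List A) {ys} → Unique (xs ++ ys) → Unique xs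
Unique-++⁻ˡ []       _        = []
Unique-++⁻ˡ (x ∷ xs) (n ∷ ns) = ++⁻ˡ xs n ∷ Unique-++⁻ˡ xs ns

Unique-resp-↭ : ∀ {xs ys : List A} → xs ↭ ys → Unique xs → Unique ys
Unique-resp-↭ {A = A} σ = PermS.Unique-resp-↭ (setoid A) (↭⇒↭ₛ σ)

Unique-++⁻ʳ : ∀ (xs : List A) {ys} → Unique (xs ++ ys) → Unique ys
Unique-++⁻ʳ []       u       = u
Unique-++⁻ʳ (x ∷ xs) (_ ∷ u) = Unique-++⁻ʳ xs u

-- Walks, cycles and alternating paths.

module Walks {V : Set} {_∼_ : V → V → Set}
             (∼-sym : ∀ {x y} → x ∼ y → y ∼ x) where

  -- Vertices may repeat; distinctness is obtained separately, by keeping the vertex list inside a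
  -- permutation of a duplicate-free list.
  data Walk : V → V → List V → Set where
    stop : ∀ x → Walk x x [ x ]
    step : ∀ {x y z vs} → x ∼ y → Walk y z vs → Walk x z (x ∷ vs)

  join : ∀ {w x y z us vs} → Walk w x us → x ∼ y → Walk y z vs → Walk w z (us ++ vs)
  join (stop _)   f q = step f q
  join (step e p) f q = step e (join p f q)

  -- The first walk is traversed backwards, so the new edge leaves from its start; this is the
  -- reversal in Dirac's argument.
  joinʳ : ∀ {w x y z us vs} → Walk x w us → x ∼ y → Walk y z vs → Walk w z (us ʳ++ vs)
  joinʳ (stop _)   f q = step f q
  joinʳ (step e p) f q = joinʳ p (∼-sym e) (step f q)

  split : ∀ {x z vs u} → Walk x z vs → u ∈ vs →
          x ≡ u ⊎ ∃[ p ] ∃₂ λ us ws → Walk x p us × p ∼ u × Walk u z ws × us ++ ws ≡ vs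
  split (stop _)   (here refl) = inj₁ refl
  split (step _ _) (here refl) = inj₁ refl
  split (step e p) (there u∈vs) with split p u∈vs
  ... | inj₁ refl = inj₂ (_ , _ , _ , stop _ , e , p , refl)
  ... | inj₂ (_ , _ , _ , q , f , r , eq) = inj₂ (_ , _ , _ , step e q , f , r , cong (_ ∷_) eq)

  -- The edge from `z` to `x` closes the walk to a cycle, which is cut open just before `u`.
  reroute : ∀ {x z vs u} → Walk x z vs → z ∼ x → u ∈ vs →
            ∃₂ λ t ws → Walk u t ws × ws ↭ vs
  reroute p e u∈vs with split p u∈vs
  ... | inj₁ refl = _ , _ , p , ↭-refl
  ... | inj₂ (_ , us , ws , q , _ , r , refl) = _ , _ , join r e q , ++-comm ws us

  data Alternating : V → V → List V → List V → Set where
    stop : ∀ x → Alternating x x [ x ] []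
    step : ∀ {x b y z as bs} → x ∼ b → b ∼ y → Alternating y z as bs →
           Alternating x z (x ∷ as) (b ∷ bs)

  snoc : ∀ {x y z b as bs} → Alternating x y as bs → y ∼ b → b ∼ z →
         Alternating x z (as ∷ʳ z) (bs ∷ʳ b)
  snoc (stop _)     e f = step e f (stop _)
  snoc (step g h p) e f = step g h (snoc p e f)

  alternating-length : ∀ {x z as bs} → Alternating x z as bs → length as ≡ suc (length bs)
  alternating-length (stop _)     = refl
  alternating-length (step _ _ p) = cong suc (alternating-length p)

  alternating⇒walk : ∀ {x z as bs} → Alternating x z as bs →
                     ∃[ vs ] Walk x z vs × vs ↭ as ++ bs
  alternating⇒walk (stop x) = _ , stop x , ↭-refl
  alternating⇒walk (step {x} {b} {as = as} {bs} e f p) with vs , q , σ ← alternating⇒walk p =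
    _ , step e (step f q) , prep x (↭-trans (prep b σ) (↭-sym (shift b as bs)))

  record AlternatingIn (S R : List V) (k : ℕ) : Set where
    constructor alternatingIn
    field
      {start end}         : V
      {as bs unusedS unusedR} : List V
      path     : Alternating start end as bs
      splitS   : as ++ unusedS ↭ S
      splitR   : bs ++ unusedR ↭ R
      bs-length : length bs ≡ k

  module _ (S R : List V) (R-unique : Unique R)
           (S-misses≤1 : ∀ {s r r′} → s ∈ S → r ∈ R → r′ ∈ R → r ≢ r′ → s ∼ r ⊎ s ∼ r′)
           where

    private
      snoc-↭ : ∀ (x : V) xs {ys zs} → xs ++ x ∷ ys ↭ zs → (xs ∷ʳ x) ++ ys ↭ zs
      snoc-↭ x xs {ys} σ = ↭-trans (↭-reflexive (++-assoc xs [ x ] ys)) σ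

    prepend : ∀ {x z a b as bs U W k} → Alternating x z as bs → a ∼ b → b ∼ x →
              as ++ a ∷ U ↭ S → bs ++ b ∷ W ↭ R → length bs ≡ k → AlternatingIn S R (suc k)
    prepend {a = a} {b} {as} {bs} p e f σ τ refl = alternatingIn (step e f p)
      (↭-trans (↭-sym (shift a as _)) σ) (↭-trans (↭-sym (shift b bs _)) τ) refl

    append : ∀ {x z a b as bs U W k} → Alternating x z as bs → z ∼ b → b ∼ a →
             as ++ a ∷ U ↭ S → bs ++ b ∷ W ↭ R → length bs ≡ k → AlternatingIn S R (suc k)
    append {a = a} {b} {as} {bs} p e f σ τ refl = alternatingIn (snoc p e f)
      (snoc-↭ a as σ) (snoc-↭ b bs τ)
      (trans (length-++ bs) (+-comm (length bs) 1))

    private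
      start∈ : ∀ {x z as bs} → Alternating x z as bs → x ∈ as
      start∈ (stop _)     = here refl
      start∈ (step _ _ _) = here refl

      end∈ : ∀ {x z as bs} → Alternating x z as bs → z ∈ as
      end∈ (stop _)     = here refl
      end∈ (step _ _ p) = there (end∈ p)

      swap-unused : ∀ {b b′} bs {W} → bs ++ b ∷ b′ ∷ W ↭ R → bs ++ b′ ∷ b ∷ W ↭ R
      swap-unused bs τ = ↭-trans (++⁺ˡ bs (swap _ _ ↭-refl)) τ

      unused∈ : ∀ {b} bs {W} → bs ++ b ∷ W ↭ R → b ∈ R
      unused∈ bs τ = ∈-resp-↭ τ (∈-++⁺ʳ bs (here refl))

      unused≢ : ∀ {b b′} bs {W} → bs ++ b ∷ b′ ∷ W ↭ R → b ≢ b′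
      unused≢ bs τ with Unique-++⁻ʳ bs (Unique-resp-↭ (↭-sym τ) R-unique)
      ... | (b≢b′ ∷ _) ∷ _ = b≢b′

      sees : ∀ {s b b′} bs {W} → s ∈ S → bs ++ b ∷ b′ ∷ W ↭ R → s ∼ b ⊎ s ∼ b′
      sees bs s∈ τ =
        S-misses≤1 s∈ (unused∈ bs τ) (unused∈ bs (swap-unused bs τ)) (unused≢ bs τ)

    -- The path and `b′` form a cycle, which `u` can enter next to any vertex of `R` on it that `u`
    -- sees. As `u` misses at most one vertex of `R`, it sees `b′` or the first vertex `b₁` of `bs`.
    enterCycle : ∀ {x z u as bs U b b′ W} → Alternating x z as bs →
                 as ++ u ∷ U ↭ S → bs ++ b ∷ b′ ∷ W ↭ R → 1 ≤ length bs ⊎ 1 ≤ length U →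
                 u ∼ b → b′ ∼ x → z ∼ b′ → AlternatingIn S R (suc (length bs))
    -- A one-vertex path has no `b₁`. A third vertex `u′` of `S` helps: it sees `b`, which gives u,
    -- b, u′ without `x`, or it sees `b′`, which gives u′, b′, x.
    enterCycle {U = u′ ∷ U} p@(stop x) σ τ (inj₂ _) u∼b b′∼x _
      with sees [] (∈-resp-↭ σ (there (there (here refl)))) τ
    ... | inj₁ u′∼b  = alternatingIn (step u∼b (∼-sym u′∼b) (stop u′))
                         (↭-trans (shift x (_ ∷ u′ ∷ []) U) σ) τ refl
    ... | inj₂ u′∼b′ = prepend p u′∼b′ b′∼x (↭-trans (prep x (swap _ _ ↭-refl)) σ)
                         (swap-unused [] τ) refl
    enterCycle {U = []} (stop _) _ _ (inj₁ ())
    enterCycle {U = []} (stop _) _ _ (inj₂ ())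
    enterCycle {u = u} {U = U} {b = b} {b′} {W}
               p@(step {x} {b₁} {as = as} {bs} e f q) σ τ _ _ b′∼x z∼b′
      with S-misses≤1 {u} (∈-resp-↭ σ (∈-++⁺ʳ (x ∷ as) (here refl))) (∈-resp-↭ τ (here refl))
             (unused∈ (b₁ ∷ bs) (swap-unused (b₁ ∷ bs) τ)) b₁≢b′
      where
      b₁≢b′ : b₁ ≢ b′
      b₁≢b′ with Unique-resp-↭ (↭-sym τ) R-unique
      ... | b₁≢ ∷ _ = All.lookup b₁≢ (∈-++⁺ʳ bs (there (here refl)))
    ... | inj₂ u∼b′ = prepend p u∼b′ b′∼x σ (swap-unused (b₁ ∷ bs) τ) refl
    -- The vertex `u` takes the place of `x` in front of `b₁`, and `x` comes back behind `z` and
    -- `b′`.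
    ... | inj₁ u∼b₁ = alternatingIn (snoc (step u∼b₁ f q) z∼b′ b′∼x)
                        (snoc-↭ x (u ∷ as) (↭-trans reorder σ))
                        (snoc-↭ b′ (b₁ ∷ bs) (swap-unused (b₁ ∷ bs) τ))
                        (cong suc (trans (length-++ bs) (+-comm (length bs) 1)))
      where
      reorder : u ∷ as ++ x ∷ U ↭ x ∷ as ++ u ∷ U
      reorder = ↭-trans (prep u (shift x as U))
                  (↭-trans (swap u x ↭-refl) (prep x (↭-sym (shift u as U))))

    -- If the path cannot be extended at an end, then both its ends see b′ while u does not, so
    -- b′ closes it to a cycle, which u can enter at the first vertex of bs.
    growVia : ∀ {x z u as bs U b b′ W} → Alternating x z as bs →
              as ++ u ∷ U ↭ S → bs ++ b ∷ b′ ∷ W ↭ R → 1 ≤ length bs ⊎ 1 ≤ length U →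
              u ∼ b → AlternatingIn S R (suc (length bs))
    growVia {bs = bs} p σ τ spare u∼b
      with sees bs (∈-resp-↭ σ (∈-++⁺ˡ (start∈ p))) τ | sees bs (∈-resp-↭ σ (∈-++⁺ˡ (end∈ p))) τ
    ... | inj₁ x∼b  | _         = prepend p u∼b (∼-sym x∼b) σ τ refl
    ... | inj₂ _    | inj₁ z∼b  = append p z∼b (∼-sym u∼b) σ τ refl
    ... | inj₂ x∼b′ | inj₂ z∼b′ = enterCycle p σ τ spare u∼b (∼-sym x∼b′) z∼b′

    growUnused : ∀ {x z as bs U W} → Alternating x z as bs → as ++ U ↭ S → bs ++ W ↭ R →
                 1 ≤ length U → 2 ≤ length W → 1 ≤ length bs ⊎ 2 ≤ length U →
                 AlternatingIn S R (suc (length bs))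
    growUnused {as = as} {bs} {u ∷ U} {b ∷ b′ ∷ W} p σ τ _ (s≤s (s≤s _)) spare
      with sees bs (unused∈S as σ) τ
      where
      unused∈S : ∀ as → as ++ u ∷ U ↭ S → u ∈ S
      unused∈S as σ = ∈-resp-↭ σ (∈-++⁺ʳ as (here refl))
    ... | inj₁ u∼b  = growVia p σ τ (map₂ s≤s⁻¹ spare) u∼b
    ... | inj₂ u∼b′ = growVia p σ (swap-unused bs τ) (map₂ s≤s⁻¹ spare) u∼b′

    module _ (∣R∣≤∣S∣ : length R ≤ length S) (3≤∣S∣ : 3 ≤ length S) where

      grow : ∀ {k} → 2 + k ≤ length R → AlternatingIn S R k → AlternatingIn S R (suc k)
      grow 2+k≤∣R∣ (alternatingIn {as = as} {bs} {U} {W} p σ τ refl) =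
        growUnused p σ τ
          (+-cancelˡ-≤ (length as) 1 _ (begin
            length as + 1         ≡⟨ cong (_+ 1) (alternating-length p) ⟩
            suc (length bs + 1)   ≡⟨ cong suc (+-comm _ 1) ⟩
            2 + length bs         ≤⟨ 2+k≤∣R∣ ⟩
            length R              ≤⟨ ∣R∣≤∣S∣ ⟩
            length S              ≡⟨ lenS ⟨
            length as + length U  ∎))
          (+-cancelˡ-≤ (length bs) 2 _ (begin
            length bs + 2         ≡⟨ +-comm _ 2 ⟩
            2 + length bs         ≤⟨ 2+k≤∣R∣ ⟩
            length R              ≡⟨ trans (sym (length-++ bs)) (↭-length τ) ⟨
            length bs + length W  ∎))
          (spare p lenS)
        where
        open ≤-Reasoning
        lenS : length as + length U ≡ length S
        lenS = trans (sym (length-++ as)) (↭-length σ)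
        spare : ∀ {x z as bs} → Alternating x z as bs → length as + length U ≡ length S →
                1 ≤ length bs ⊎ 2 ≤ length U
        -- A one-vertex path leaves at least two of the three or more vertices of `S`.
        spare (stop _)     eq = inj₂ (s≤s⁻¹ (subst (3 ≤_) (sym eq) 3≤∣S∣))
        spare (step _ _ _) _  = inj₁ (s≤s z≤n)

      alternatingOfLength : ∀ k → suc k ≤ length R → AlternatingIn S R k
      alternatingOfLength zero    _ = initial S ↭-refl 3≤∣S∣
        where
        initial : ∀ S′ → S′ ↭ S → 3 ≤ length S′ → AlternatingIn S R 0
        initial (s ∷ _) σ _ = alternatingIn (stop s) σ ↭-refl refl
      alternatingOfLength (suc k) k<∣R∣ =
        grow k<∣R∣ (alternatingOfLength k (≤-trans (n≤1+n _) k<∣R∣))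


-- Dirac's argument: a Hamiltonian path from large minimum degree.

module _ {N : ℕ} (G : Graph N) where

  infix 4 _∼_
  _∼_ : Fin N → Fin N → Set
  x ∼ y = adj G x y ≡ true

  ∼-sym : ∀ {x y} → x ∼ y → y ∼ x
  ∼-sym {x} {y} e = trans (Graph.sym G y x) e

  open Walks {Fin N} {_∼_} ∼-sym

  adjacent? : ∀ x y → x ∼ y ⊎ adj G x y ≡ false
  adjacent? x y with adj G x y
  ... | true  = inj₁ refl
  ... | false = inj₂ refl

  private
    -- When a vertex is put in front, the correction `f` for the old first vertex becomes a mark on
    -- the new edge, beside the mark `g`. If these are at most one mark together, the extra unit of
    -- length pays for them.
    crossing-step : ∀ a g f {c e} l z → g + f ≤ 1 → c + e < l + (f + z) →
                    (a + c) + (g + e) < suc l + (a + z)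
    crossing-step a g f {c} {e} l z g+f≤1 lt = begin-strict
      (a + c) + (g + e)     ≡⟨ lemma₁ a c g e ⟩
      (a + g) + (c + e)     <⟨ +-monoʳ-< (a + g) lt ⟩
      (a + g) + (l + (f + z)) ≡⟨ lemma₂ a g l f z ⟩
      (g + f) + (l + (a + z)) ≤⟨ +-monoˡ-≤ _ g+f≤1 ⟩
      suc l + (a + z)       ∎
      where
      open ≤-Reasoning
      lemma₁ : ∀ a c g e → (a + c) + (g + e) ≡ (a + g) + (c + e)
      lemma₁ = solve-∀
      lemma₂ : ∀ a g l f z → (a + g) + (l + (f + z)) ≡ (g + f) + (l + (a + z))
      lemma₂ = solve-∀

    indicator≤1 : ∀ b → indicator b ≤ 1
    indicator≤1 true  = ≤-refl
    indicator≤1 false = z≤n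

  -- Pigeonhole on the edges of the walk: a vertex with f, other than the first, marks the edge into
  -- it, and a vertex with g, other than the last, the edge out of it.
  crossing : ∀ (f g : Fin N → Bool) {x z vs} → Walk x z vs →
    (∃₂ λ p q → ∃₂ λ us ws → Walk x p us × p ∼ q × Walk q z ws × us ++ ws ≡ vs ×
                             g p ≡ true × f q ≡ true)
    ⊎ count f vs + count g vs < length vs + (indicator (f x) + indicator (g z))
  crossing f g (stop x) = inj₂ (s≤s (≤-reflexive
    (cong₂ _+_ (+-identityʳ (indicator (f x))) (+-identityʳ (indicator (g x))))))
  crossing f g (step {x} {y} {z} {vs} e p) with g x in gx | f y in fy | crossing f g p
  ... | _     | _     | inj₁ (_ , _ , _ , _ , q , h , r , eq , gp , fq) =
    inj₁ (_ , _ , _ , _ , step e q , h , r , cong (x ∷_) eq , gp , fq)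
  ... | true  | true  | inj₂ _  = inj₁ (x , y , _ , _ , stop x , e , p , refl , gx , fy)
  ... | true  | false | inj₂ lt =
    inj₂ (crossing-step (indicator (f x)) 1 0 (length vs) (indicator (g z)) ≤-refl lt)
  ... | false | b     | inj₂ lt =
    inj₂ (crossing-step (indicator (f x)) 0 _ (length vs) (indicator (g z)) (indicator≤1 b) lt)

  module _ (d : ℕ) (N≡ : N ≡ suc (d + d)) (minDegree : ∀ x → d ≤ count (adj G x) (allFin N)) where

    -- The two counts sum to at least d + d, on at most d + d vertices, and no end is its own
    -- neighbour, so `crossing` gives consecutive p, q with z adjacent to p and x to q. The cycle
    -- goes from p back to x, over to q, on to z and back to p.
    closeUp : ∀ {x z vs} → Walk x z vs → d ≤ count (adj G x) vs → d ≤ count (adj G z) vs →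
              length vs ≤ d + d →
              ∃₂ λ u t → ∃[ ws ] Walk u t ws × t ∼ u × ws ↭ vs
    closeUp {x} {z} {vs} p dx dz len with crossing (adj G x) (adj G z) p
    ... | inj₁ (_ , _ , us , ws , q , _ , r , refl , z∼ , x∼) =
      _ , _ , _ , joinʳ q x∼ r , z∼ , ↭-sym (++↭ʳ++ us ws)
    ... | inj₂ lt = contradiction lt (≤⇒≯ (begin
      length vs + (indicator (adj G x x) + indicator (adj G z z))
        ≡⟨ cong (length vs +_) (cong₂ (λ a b → indicator a + indicator b)
             (Graph.irrefl G x) (Graph.irrefl G z)) ⟩
      length vs + 0                           ≡⟨ +-identityʳ _ ⟩
      length vs                               ≤⟨ len ⟩
      d + d                                   ≤⟨ +-mono-≤ dx dz ⟩
      count (adj G x) vs + count (adj G z) vs ∎))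
      where open ≤-Reasoning

    degree-split : ∀ x {vs ys} → vs ++ ys ↭ allFin N →
                   d ≤ count (adj G x) vs + count (adj G x) ys
    degree-split x {vs} {ys} σ = subst (d ≤_)
      (trans (sym (count-↭ (adj G x) σ)) (count-++ (adj G x) vs ys)) (minDegree x)

    degree-within : ∀ x {vs ys} → vs ++ ys ↭ allFin N → All (λ y → adj G x y ≡ false) ys →
                    d ≤ count (adj G x) vs
    degree-within x {vs} {ys} σ none = subst (d ≤_)
      (trans (cong (count (adj G x) vs +_) (count-none (adj G x) none)) (+-identityʳ _))
      (degree-split x {vs} {ys} σ)

    -- Keeping the unvisited `ys` next to `vs` in a permutation of `allFin N` makes the walk a path
    -- and lets degrees be split into a part inside and a part outside.
    PathAndRest : ℕ → Set
    PathAndRest k = ∃₂ λ x z → ∃₂ λ vs ys → Walk x z vs × vs ++ ys ↭ allFin N × length vs ≡ k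

    private
      move : ∀ {vs ws ys ys′ : List (Fin N)} {y} → vs ++ ys ↭ allFin N → ys ↭ y ∷ ys′ →
             ws ↭ vs → y ∷ ws ++ ys′ ↭ allFin N
      move {vs} {ws} {ys} {ys′} {y} σ τ ρ =
        ↭-trans (↭-sym (shift y ws ys′)) (↭-trans (++⁺ ρ (↭-sym τ)) σ)

    -- The walk contains `x`, which is not its own neighbour.
    count<length : ∀ {x z vs} → Walk x z vs → count (adj G x) vs < length vs
    count<length (stop x) rewrite Graph.irrefl G x = s≤s z≤n
    count<length (step {x} {vs = vs} _ _) rewrite Graph.irrefl G x = s≤s (count≤length (adj G x) vs)

    -- If neither end has a neighbour outside, the walk closes up to a cycle. An outside vertex `y`
    -- has a neighbour `u` on it; cutting the cycle open at `u` and putting `y` in front gains a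
    -- vertex.
    extend : ∀ {k} → suc k ≤ N → PathAndRest k → PathAndRest (suc k)
    extend k<N (x , z , vs , ys , p , σ , refl) with pick (adjacent? x) ys
    ... | inj₁ (y , ys′ , x∼y , τ) =
      y , z , y ∷ vs , ys′ , step (∼-sym x∼y) p , move σ τ ↭-refl , refl
    ... | inj₂ x-none with pick (adjacent? z) ys
    ...   | inj₁ (y , ys′ , z∼y , τ) =
      x , y , vs ∷ʳ y , ys′ , join p z∼y (stop y) ,
      ↭-trans (++⁺ʳ ys′ (++-comm vs [ y ])) (move σ τ ↭-refl) ,
      trans (length-++ vs) (+-comm (length vs) 1)
    ...   | inj₂ z-none = enter ys refl
      where
      dx : d ≤ count (adj G x) vs
      dx = degree-within x σ x-none

      lenσ : length vs + length ys ≡ N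
      lenσ = trans (sym (length-++ vs)) (trans (↭-length σ) (length-tabulate id))

      enter : ∀ ws → ws ≡ ys → PathAndRest (suc (length vs))
      enter [] refl = contradiction (trans (sym (+-identityʳ _)) lenσ) (<⇒≢ k<N)
      enter (y ∷ ys′) refl with pick (adjacent? y) vs
      -- Otherwise `x` and its neighbours lie on the walk, `y` and its neighbours off it: two
      -- disjoint sets of at least d + 1 vertices, too many for N = 2d + 1.
      ... | inj₂ y-none = contradiction (≤-trans (+-mono-≤ sd≤∣vs∣ (s≤s d≤∣ys′∣)) (≤-reflexive lenσ))
                            (<⇒≱ (s≤s (≤-reflexive (trans N≡ (sym (+-suc d d))))))
        where
        open ≤-Reasoning
        sd≤∣vs∣ : suc d ≤ length vs
        sd≤∣vs∣ = ≤-trans (s≤s dx) (count<length p)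
        d≤∣ys′∣ : d ≤ length ys′
        d≤∣ys′∣ = begin
          d                                              ≤⟨ degree-split y {vs} {y ∷ ys′} σ ⟩
          count (adj G y) vs + count (adj G y) (y ∷ ys′)
            ≡⟨ cong₂ _+_ (count-none (adj G y) y-none)
                 (cong (λ b → indicator b + count (adj G y) ys′) (Graph.irrefl G y)) ⟩
          count (adj G y) ys′                            ≤⟨ count≤length (adj G y) ys′ ⟩
          length ys′                                     ∎
      ... | inj₁ (u , _ , y∼u , τ)
        with _ , _ , _ , c , t∼u , ρ ← closeUp p dx (degree-within z σ z-none)
                                     (s≤s⁻¹ (subst (suc (length vs) ≤_) N≡ k<N))
        with _ , _ , q , π ← reroute c t∼u (∈-resp-↭ (↭-sym (↭-trans ρ τ)) (here refl)) =
        _ , _ , _ , ys′ , step y∼u q , move σ ↭-refl (↭-trans π ρ) , cong suc (↭-length (↭-trans π ρ))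

    pathAndRest : ∀ k → suc k ≤ N → PathAndRest (suc k)
    pathAndRest zero    1≤N = single (allFin N) refl
      where
      single : ∀ vs → vs ≡ allFin N → PathAndRest 1
      single []       eq = contradiction (subst (1 ≤_) N≡0 1≤N) λ ()
        where
        N≡0 : N ≡ 0
        N≡0 = trans (sym (length-tabulate id)) (cong length (sym eq))
      single (v ∷ vs) eq = v , v , [ v ] , vs , stop v , ↭-reflexive eq , refl
    pathAndRest (suc k) k<N = extend k<N (pathAndRest k (≤-trans (n≤1+n _) k<N))

-- Embedding paths and trees along lists of vertices.

nth : A → List A → ℕ → A
nth d []       _       = d
nth d (x ∷ xs) zero    = x
nth d (x ∷ xs) (suc i) = nth d xs i

nth-∈ : ∀ {d : A} {xs i} → i < length xs → nth d xs i ∈ xs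
nth-∈ {xs = x ∷ xs} {zero}  _         = here refl
nth-∈ {xs = x ∷ xs} {suc i} (s≤s i<n) = there (nth-∈ i<n)

nth-++ˡ : ∀ {d : A} {i} xs {ys} → i < length xs → nth d (xs ++ ys) i ≡ nth d xs i
nth-++ˡ {i = zero}  (x ∷ xs) _         = refl
nth-++ˡ {i = suc i} (x ∷ xs) (s≤s i<n) = nth-++ˡ xs i<n

nth-++ʳ : ∀ {d : A} xs {ys} i → nth d (xs ++ ys) (length xs + i) ≡ nth d ys i
nth-++ʳ []       i = refl
nth-++ʳ (x ∷ xs) i = nth-++ʳ xs i

nth-injective : ∀ {d : A} {xs i j} → Unique xs → i < length xs → j < length xs →
                nth d xs i ≡ nth d xs j → i ≡ j
nth-injective {xs = _ ∷ _} {zero}  {zero}  _          _         _         _  = refl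
nth-injective {xs = _ ∷ _} {zero}  {suc j} (n ∷ _)    _         (s≤s j<n) eq =
  contradiction eq (All.lookup n (nth-∈ j<n))
nth-injective {xs = _ ∷ _} {suc i} {zero}  (n ∷ _)    (s≤s i<n) _         eq =
  contradiction (sym eq) (All.lookup n (nth-∈ i<n))
nth-injective {xs = _ ∷ _} {suc i} {suc j} (_ ∷ uniq) (s≤s i<n) (s≤s j<n) eq =
  cong suc (nth-injective uniq i<n j<n eq)

symClose⁻ : ∀ {m} (R : Fin m → Fin m → Bool) i j → adj (symClose m R) i j ≡ true →
            R i j ≡ true ⊎ R j i ≡ true
symClose⁻ R i j e with i Fin.≟ j
symClose⁻ R i j () | yes _
symClose⁻ R i j e  | no _ with R i j
... | true  = inj₁ refl
... | false = inj₂ e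

symClose⁺ : ∀ {m} (R : Fin m → Fin m → Bool) i j → i ≢ j → R i j ≡ true →
            adj (symClose m R) i j ≡ true
symClose⁺ R i j i≢j e with i Fin.≟ j
... | yes i≡j = contradiction i≡j i≢j
... | no _ rewrite e = refl

complement⁺ : ∀ {N} (G : Graph N) {u v} → u ≢ v → adj G u v ≡ false →
              adj (complement G) u v ≡ true
complement⁺ G {u} {v} u≢v e with u Fin.≟ v
... | yes u≡v = contradiction u≡v u≢v
... | no _    = cong not e

complement⁻ : ∀ {N} (G : Graph N) {u v} → adj (complement G) u v ≡ true → adj G u v ≡ false
complement⁻ G {u} {v} e with u Fin.≟ v
complement⁻ G {u} {v} () | yes _
... | no _ with adj G u v
...   | false = refl

adj⇒≢ : ∀ {N} (G : Graph N) {u v} → adj G u v ≡ true → u ≢ v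
adj⇒≢ G {u} e refl with () ← trans (sym e) (Graph.irrefl G u)

module _ {N m : ℕ} (G : Graph N) (d : Fin N) {xs : List (Fin N)} (uniq : Unique xs)
         (m≤n : m ≤ length xs) (R : Fin m → Fin m → Bool) where

  private
    f : Fin m → Fin N
    -- The default `d` is never returned, since `toℕ i` is below `m` and hence below the length of
    -- `xs`.
    f i = nth d xs (toℕ i)

    f-injective : ∀ {i j} → f i ≡ f j → i ≡ j
    f-injective {i} {j} eq = toℕ-injective
      (nth-injective uniq (<-≤-trans (toℕ<n i) m≤n) (<-≤-trans (toℕ<n j) m≤n) eq)

  symClose-contained : (∀ i j → R i j ≡ true → adj G (f i) (f j) ≡ true) →
                       Contains G (symClose m R)
  symClose-contained hom = f , f-injective , λ i j e →
    [ hom i j , (λ r → trans (Graph.sym G (f i) (f j)) (hom j i r)) ]′ (symClose⁻ R i j e)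

  symClose-contained-complement : (∀ i j → R i j ≡ true → adj G (f i) (f j) ≡ false) →
                                  Contains (complement G) (symClose m R)
  symClose-contained-complement hom = f , f-injective , λ i j e →
    complement⁺ G (adj⇒≢ (symClose m R) e ∘ f-injective)
      ([ hom i j , (λ r → trans (Graph.sym G (f i) (f j)) (hom j i r)) ]′ (symClose⁻ R i j e))

module _ {N : ℕ} (G : Graph N) where

  open Walks {Fin N} {λ x y → adj G x y ≡ true} (∼-sym G)

  walk-nth : ∀ {d x z vs i} → Walk x z vs → suc i < length vs →
             adj G (nth d vs i) (nth d vs (suc i)) ≡ true
  walk-nth {i = _}     (stop _)                (s≤s ())
  walk-nth {i = zero}  (step e (stop _))       _         = e
  walk-nth {i = zero}  (step e (step _ _))     _         = e
  walk-nth {i = suc i} (step e p)              (s≤s i<n) = walk-nth p i<n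

  -- The first `m` vertices of the walk are taken, so one long walk serves all shorter paths.
  walk⇒Path : ∀ {x z vs m} → Walk x z vs → Unique vs → m ≤ length vs → Contains G (Path m)
  walk⇒Path {x} {vs = vs} {m} p uniq m≤n =
    symClose-contained G x uniq m≤n (λ u v → suc (toℕ u) ≡ᵇ toℕ v) hom
    where
    hom : ∀ (i j : Fin m) → (suc (toℕ i) ≡ᵇ toℕ j) ≡ true →
          adj G (nth x vs (toℕ i)) (nth x vs (toℕ j)) ≡ true
    hom i j e with eq ← ≡ᵇ⇒≡ (suc (toℕ i)) (toℕ j) (Equivalence.from T-≡ e) =
      subst (λ k → adj G (nth x vs (toℕ i)) (nth x vs k) ≡ true) eq
        (walk-nth p (subst (_< length vs) (sym eq) (<-≤-trans (toℕ<n j) m≤n)))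

-- The common shape of `T1` and `T2`: spokes from 0 to 1, ..., k and two pendant edges pq and rs.
treeEdge : (k p q r s : ℕ) → ℕ → ℕ → Bool
treeEdge k p q r s a b = ((a ≡ᵇ 0) ∧ (1 ≤ᵇ b) ∧ (b ≤ᵇ k))
                       ∨ ((a ≡ᵇ p) ∧ (b ≡ᵇ q))
                       ∨ ((a ≡ᵇ r) ∧ (b ≡ᵇ s))

treeEdge⁻ : ∀ k p q r s a b → treeEdge k p q r s a b ≡ true →
            (a ≡ 0 × 1 ≤ b × b ≤ k) ⊎ (a ≡ p × b ≡ q) ⊎ (a ≡ r × b ≡ s)
treeEdge⁻ k p q r s a b e with Equivalence.to T-∨ (Equivalence.from T-≡ e)
... | inj₁ t with t₁ , t′ ← Equivalence.to T-∧ t with t₂ , t₃ ← Equivalence.to (T-∧ {1 ≤ᵇ b}) t′ =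
  inj₁ (≡ᵇ⇒≡ a 0 t₁ , ≤ᵇ⇒≤ 1 b t₂ , ≤ᵇ⇒≤ b k t₃)
... | inj₂ t with Equivalence.to (T-∨ {(a ≡ᵇ p) ∧ (b ≡ᵇ q)}) t
...   | inj₁ u with u₁ , u₂ ← Equivalence.to (T-∧ {a ≡ᵇ p}) u =
  inj₂ (inj₁ (≡ᵇ⇒≡ a p u₁ , ≡ᵇ⇒≡ b q u₂))
...   | inj₂ u with u₁ , u₂ ← Equivalence.to (T-∧ {a ≡ᵇ r}) u =
  inj₂ (inj₂ (≡ᵇ⇒≡ a r u₁ , ≡ᵇ⇒≡ b s u₂))

module _ {N : ℕ} (G : Graph N) (v : Fin N) where

  infix 4 _≁_
  _≁_ : Fin N → Fin N → Set
  x ≁ y = adj G x y ≡ false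

  -- The list puts the centre `v` at position 0 and its leaves right after it, so the spokes follow
  -- from `v≁ls` and only the pendant edges are left to `hom`.
  tree-contained : ∀ {n k p q r s} ls rest →
    Unique (v ∷ ls ++ rest) → n ≤ length (v ∷ ls ++ rest) →
    k ≤ length ls → All (v ≁_) ls →
    (∀ a b → a ≡ p × b ≡ q ⊎ a ≡ r × b ≡ s → nth v (v ∷ ls ++ rest) a ≁ nth v (v ∷ ls ++ rest) b) →
    Contains (complement G) (symClose n (λ i j → treeEdge k p q r s (toℕ i) (toℕ j)))
  tree-contained {n} {k} {p} {q} {r} {s} ls rest uniq n≤ k≤ v≁ls hom =
    symClose-contained-complement G v uniq n≤ _ hom′
    where
    xs = v ∷ ls ++ rest
    hom′ : ∀ (i j : Fin n) → treeEdge k p q r s (toℕ i) (toℕ j) ≡ true →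
           nth v xs (toℕ i) ≁ nth v xs (toℕ j)
    hom′ i j e with toℕ i | toℕ j | treeEdge⁻ k p q r s (toℕ i) (toℕ j) e
    ... | .0 | suc b | inj₁ (refl , _ , b<k) with b<n ← <-≤-trans b<k k≤
      rewrite nth-++ˡ {d = v} ls {rest} b<n = All.lookup v≁ls (nth-∈ b<n)
    ... | a | b | inj₂ ab = hom a b ab

  private
    nth-offset : ∀ {l} L us ws i → length L ≡ l →
                 nth v (v ∷ (L ++ us) ++ ws) (suc (i + l)) ≡ nth v (us ++ ws) i
    nth-offset L us ws i refl rewrite ++-assoc L us ws | +-comm i (length L) = nth-++ʳ L i

    length-++-comm : ∀ {l} (L us : List (Fin N)) → length L ≡ l → length (L ++ us) ≡ length us + l
    length-++-comm L us refl = trans (length-++ L) (+-comm (length L) (length us))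

    length-++-comm₂ : ∀ {l} (L us ws : List (Fin N)) → length L ≡ l →
                      length ((L ++ us) ++ ws) ≡ length (us ++ ws) + l
    length-++-comm₂ L us ws eq = trans (cong length (++-assoc L us ws)) (length-++-comm L (us ++ ws) eq)

  -- With n = 8 + j, the length of `L` puts `a`, `a′`, `x`, `x′` at positions n - 4, n - 3, n - 2, n
  -- - 1.
  T1-contained : ∀ {j a a′ x x′} L → length L ≡ 3 + j →
                 Unique (v ∷ (L ++ a ∷ a′ ∷ []) ++ x ∷ x′ ∷ []) →
                 All (v ≁_) (L ++ a ∷ a′ ∷ []) → a ≁ x → a′ ≁ x′ →
                 Contains (complement G) (T1 (8 + j))
  T1-contained {j} {a} {a′} {x} {x′} L lenL uniq v≁ a≁x a′≁x′ =
    tree-contained (L ++ us) ws uniq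
      (≤-reflexive (sym (cong suc (length-++-comm₂ L us ws lenL))))
      (≤-reflexive (sym (length-++-comm L us lenL))) v≁ λ where
        _ _ (inj₁ (refl , refl)) → trans (cong₂ (adj G) (at 0) (at 2)) a≁x
        _ _ (inj₂ (refl , refl)) → trans (cong₂ (adj G) (at 1) (at 3)) a′≁x′
    where
    us ws : List (Fin N)
    us = a ∷ a′ ∷ []
    ws = x ∷ x′ ∷ []
    at = λ i → nth-offset L us ws i lenL

  -- Here `L` is one longer, so that `a`, the end of both pendant edges, lands at n - 3.
  T2-contained : ∀ {j a x x′} L → length L ≡ 4 + j → Unique (v ∷ (L ++ a ∷ []) ++ x ∷ x′ ∷ []) →
                 All (v ≁_) (L ++ a ∷ []) → a ≁ x → a ≁ x′ →
                 Contains (complement G) (T2 (8 + j))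
  T2-contained {j} {a} {x} {x′} L lenL uniq v≁ a≁x a≁x′ =
    tree-contained (L ++ us) ws uniq
      (≤-reflexive (sym (cong suc (length-++-comm₂ L us ws lenL))))
      (≤-reflexive (sym (length-++-comm L us lenL))) v≁ λ where
        _ _ (inj₁ (refl , refl)) → trans (cong₂ (adj G) (at 0) (at 1)) a≁x
        _ _ (inj₂ (refl , refl)) → trans (cong₂ (adj G) (at 0) (at 2)) a≁x′
    where
    us ws : List (Fin N)
    us = a ∷ []
    ws = x ∷ x′ ∷ []
    at = λ i → nth-offset L us ws i lenL

-- The star at a vertex of small degree: a tree in the complement or an alternating path.

++-interchange : ∀ (as us bs ws : List A) → (as ++ us) ++ (bs ++ ws) ↭ (as ++ bs) ++ (us ++ ws)
++-interchange as us bs ws = begin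
  (as ++ us) ++ (bs ++ ws) ≡⟨ ++-assoc as us (bs ++ ws) ⟩
  as ++ us ++ bs ++ ws     ↭⟨ ++⁺ˡ as (shifts us bs) ⟩
  as ++ bs ++ us ++ ws     ≡⟨ ++-assoc as bs (us ++ ws) ⟨
  (as ++ bs) ++ (us ++ ws) ∎
  where open PermutationReasoning

module _ {N : ℕ} (G : Graph N) where

  open Walks {Fin N} {_∼_ G} (∼-sym G)

  -- An alternating path through all but one vertex of `R` has 2 + j vertices there and 3 + j in
  -- `S`, which for n = 8 + j makes 2n - 11.
  bipartite⇒Path : ∀ {j m} S R → Unique (S ++ R) → length R ≡ 3 + j → 4 + j ≤ length S →
    (∀ {s r r′} → s ∈ S → r ∈ R → r′ ∈ R → r ≢ r′ → adj G s r ≡ true ⊎ adj G s r′ ≡ true) →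
    m ≤ 5 + (j + j) → Contains G (Path m)
  bipartite⇒Path {j} S R uniq lenR lenS sees m≤
    with alternatingIn {as = as} {bs} {U} {W} p σ τ refl′ ←
           alternatingOfLength S R (Unique-++⁻ʳ S uniq) sees
             (≤-trans (≤-reflexive lenR) (≤-trans (n≤1+n _) lenS))
             (≤-trans (s≤s (s≤s (s≤s z≤n))) lenS) (2 + j) (≤-reflexive (sym lenR))
    with vs , q , ρ ← alternating⇒walk p =
    walk⇒Path G q
      (Unique-++⁻ˡ vs (Unique-resp-↭ (↭-sym
        (↭-trans (++⁺ʳ (U ++ W) ρ) (↭-trans (↭-sym (++-interchange as U bs W)) (++⁺ σ τ)))) uniq))
      (≤-trans m≤ (≤-reflexive (sym (begin
        length vs             ≡⟨ ↭-length ρ ⟩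
        length (as ++ bs)     ≡⟨ length-++ as ⟩
        length as + length bs ≡⟨ cong (_+ length bs) (alternating-length p) ⟩
        suc (length bs) + length bs ≡⟨ cong (λ k → suc k + k) refl′ ⟩
        3 + j + (2 + j)       ≡⟨ lemma j ⟩
        5 + (j + j)           ∎))))
    where
    open ≡-Reasoning
    lemma : ∀ j → 3 + j + (2 + j) ≡ 5 + (j + j)
    lemma = solve-∀

  module _ {j m : ℕ} (m≤ : m ≤ 5 + (j + j)) (v : Fin N) (A B : List (Fin N))
           (σ : v ∷ A ++ B ↭ allFin N) (∣A∣ : length A ≡ 5 + j) (∣B∣ : length B ≡ 3 + j)
           (v≁A : All (λ a → adj G v a ≡ false) A) where

    private
      Misses : Fin N → List (Fin N) → Set
      Misses a ys = ∃₂ λ y zs → adj G a y ≡ false × ys ↭ y ∷ zs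

      MissesTwo : Fin N → Set
      MissesTwo a = ∃₂ λ x y → ∃[ zs ] adj G a x ≡ false × adj G a y ≡ false × B ↭ x ∷ y ∷ zs

      SeesAll : Fin N → List (Fin N) → Set
      SeesAll a = All (λ y → adj G a y ≡ true)

      SeesEither : Fin N → Set
      SeesEither a = ∀ {r r′} → r ∈ B → r′ ∈ B → r ≢ r′ → adj G a r ≡ true ⊎ adj G a r′ ≡ true

      misses? : ∀ a ys → Misses a ys ⊎ SeesAll a ys
      misses? a = pick ([ inj₂ , inj₁ ]′ ∘ adjacent? G a)

      -- A second miss is sought in `B₁`, after removal of the first one `x`. If there is none, `a`
      -- misses only `x`, and of two distinct vertices one is not `x`.
      missesTwo? : ∀ a → MissesTwo a ⊎ SeesEither a
      missesTwo? a with misses? a B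
      ... | inj₂ all = inj₂ λ r∈ _ _ → inj₁ (All.lookup all r∈)
      ... | inj₁ (x , B₁ , a≁x , τ) with misses? a B₁
      ...   | inj₁ (y , B₂ , a≁y , τ′) = inj₁ (x , y , B₂ , a≁x , a≁y , ↭-trans τ (prep x τ′))
      ...   | inj₂ all = inj₂ sees
        where
        sees : SeesEither a
        sees r∈ r′∈ r≢r′ with ∈-resp-↭ τ r∈ | ∈-resp-↭ τ r′∈
        ... | there r∈₁ | _          = inj₁ (All.lookup all r∈₁)
        ... | here _    | there r′∈₁ = inj₂ (All.lookup all r′∈₁)
        ... | here refl | here refl  = contradiction refl r≢r′

      unique : Unique (A ++ B)
      unique = Unique-++⁻ʳ [ v ] (Unique-resp-↭ (↭-sym σ) (allFin⁺ N))

      star-unique : ∀ us ws {L B′} → A ↭ us ++ L → B ↭ ws ++ B′ → Unique (v ∷ (L ++ us) ++ ws)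
      star-unique us ws {L} {B′} α β =
        Unique-++⁻ˡ _ (Unique-resp-↭ (↭-trans (↭-sym σ) (prep v (begin
          A ++ B                 ↭⟨ ++⁺ (↭-trans α (++-comm us L)) β ⟩
          (L ++ us) ++ ws ++ B′  ≡⟨ ++-assoc (L ++ us) ws B′ ⟨
          ((L ++ us) ++ ws) ++ B′ ∎))) (allFin⁺ N))
        where open PermutationReasoning

      star-≁ : ∀ us {L} → A ↭ us ++ L → All (λ a → adj G v a ≡ false) (L ++ us)
      star-≁ us {L} α = All-resp-↭ (↭-trans α (++-comm us L)) v≁A

      star-T1 : ∀ {a a′ x y L B′} → A ↭ a ∷ a′ ∷ L → B ↭ x ∷ y ∷ B′ →
                adj G a x ≡ false → adj G a′ y ≡ false → Contains (complement G) (T1 (8 + j))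
      star-T1 {a} {a′} {x} {y} {L} α β = T1-contained G v L
        (suc-injective (suc-injective (trans (sym (↭-length α)) ∣A∣)))
        (star-unique (a ∷ a′ ∷ []) (x ∷ y ∷ []) α β) (star-≁ (a ∷ a′ ∷ []) α)

    -- Both pendant edges of the tree share an end, so one vertex of `A` missing two of `B`
    -- completes it.
    star⇒T2 : Contains G (Path m) ⊎ Contains (complement G) (T2 (8 + j))
    star⇒T2 with pick missesTwo? A
    ... | inj₁ (a , L , (x , y , B′ , a≁x , a≁y , β) , α) =
      inj₂ (T2-contained G v L (suc-injective (trans (sym (↭-length α)) ∣A∣))
             (star-unique [ a ] (x ∷ y ∷ []) α β) (star-≁ [ a ] α) a≁x a≁y)
    ... | inj₂ all = inj₁ (bipartite⇒Path A B unique ∣B∣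
                       (≤-trans (n≤1+n _) (≤-reflexive (sym ∣A∣))) (λ s∈ → All.lookup all s∈) m≤)

    -- The pendant edges must be disjoint. If `a` misses `x` and `x′`, then whichever `y` another
    -- `a′` misses, one of `x`, `x′` differs from `y` and is left for `a`. If no other vertex misses
    -- anything, `A′` sees all of `B`.
    star⇒T1 : Contains G (Path m) ⊎ Contains (complement G) (T1 (8 + j))
    star⇒T1 with pick missesTwo? A
    ... | inj₂ all = inj₁ (bipartite⇒Path A B unique ∣B∣
                       (≤-trans (n≤1+n _) (≤-reflexive (sym ∣A∣))) (λ s∈ → All.lookup all s∈) m≤)
    ... | inj₁ (a , A′ , (x , x′ , B′ , a≁x , a≁x′ , β) , α) with pick (λ a′ → misses? a′ B) A′
    ...   | inj₂ all = inj₁ (bipartite⇒Path A′ B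
                         (Unique-++⁻ʳ [ a ] (Unique-resp-↭ (++⁺ʳ B α) unique)) ∣B∣
                         (≤-reflexive (suc-injective (trans (sym ∣A∣) (↭-length α))))
                         (λ s∈ r∈ _ _ → inj₁ (All.lookup (All.lookup all s∈) r∈)) m≤)
    ...   | inj₁ (a′ , L , (y , B₁ , a′≁y , τ) , α′) =
      inj₂ (choose (∈-resp-↭ (↭-trans (↭-sym τ) β) (here refl)))
      where
      α″ : A ↭ a ∷ a′ ∷ L
      α″ = ↭-trans α (prep a α′)
      choose : y ∈ x ∷ x′ ∷ B′ → Contains (complement G) (T1 (8 + j))
      choose (here refl)         = star-T1 α″ (↭-trans β (swap x x′ ↭-refl)) a≁x′ a′≁y
      choose (there (here refl)) = star-T1 α″ β a≁x a′≁y
      choose (there (there y∈)) with B₂ , τ′ ← ∈⇒↭ y∈ =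
        star-T1 α″ (↭-trans β (prep x (↭-trans (prep x′ τ′) (swap x′ y ↭-refl)))) a≁x a′≁y

-- The upper bound on 2n - 7 vertices.

separate : (p : A → Bool) (xs : List A) → ∃₂ λ ys zs →
           xs ↭ ys ++ zs × All (λ x → p x ≡ true) ys × All (λ x → p x ≡ false) zs
separate p [] = [] , [] , ↭-refl , [] , []
separate p (x ∷ xs) with p x in eq | separate p xs
... | true  | ys , zs , σ , ts , fs = x ∷ ys , zs , prep x σ , eq ∷ ts , fs
... | false | ys , zs , σ , ts , fs =
  ys , x ∷ zs , ↭-trans (prep x σ) (↭-sym (shift x ys zs)) , ts , eq ∷ fs

module _ {N j : ℕ} (G : Graph N) (N≡ : N ≡ 9 + (j + j)) where

  private
    doubled : ∀ j → 9 + (j + j) ≡ suc (4 + j + (4 + j))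
    doubled = solve-∀

    split-length : ∀ j → 8 + (j + j) ≡ 3 + j + (5 + j)
    split-length = solve-∀

  -- At most 3 + j of the other 8 + 2j vertices are neighbours of `v`, so at least 5 + j are not.
  lowDegree⇒star : ∀ v → count (adj G v) (allFin N) < 4 + j → ∃₂ λ A B →
    v ∷ A ++ B ↭ allFin N × length A ≡ 5 + j × length B ≡ 3 + j ×
    All (λ a → adj G v a ≡ false) A
  lowDegree⇒star v deg<
    with rest , ρ ← ∈⇒↭ (∈-allFin v)
    with ys , zs , π , v∼ys , v≁zs ← separate (adj G v) rest =
    As , Bs , σ , lenA , lenB , take⁺ (5 + j) v≁zs
    where
    open ≤-Reasoning
    As Bs : List (Fin N)
    As = take (5 + j) zs
    -- Surplus non-neighbours join the neighbours, which fixes both sizes exactly.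
    Bs = drop (5 + j) zs ++ ys
    As++Bs : As ++ Bs ≡ zs ++ ys
    As++Bs = trans (sym (++-assoc As (drop (5 + j) zs) ys)) (cong (_++ ys) (take++drop≡id (5 + j) zs))
    σ : v ∷ As ++ Bs ↭ allFin N
    σ = ↭-sym (↭-trans ρ (prep v (↭-trans π (↭-trans (++-comm ys zs) (↭-reflexive (sym As++Bs))))))
    total : length As + length Bs ≡ 3 + j + (5 + j)
    total = trans (sym (length-++ As)) (suc-injective (trans (↭-length σ)
              (trans (length-tabulate id) (trans N≡ (cong suc (split-length j))))))
    ∣ys∣≤ : length ys ≤ 3 + j
    ∣ys∣≤ = s≤s⁻¹ (begin-strict
      length ys                                      ≡⟨ count-all (adj G v) v∼ys ⟨
      count (adj G v) ys                             ≤⟨ m≤m+n _ _ ⟩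
      count (adj G v) ys + count (adj G v) zs        ≡⟨ count-++ (adj G v) ys zs ⟨
      count (adj G v) (ys ++ zs)                     ≤⟨ m≤n+m _ _ ⟩
      count (adj G v) (v ∷ ys ++ zs)                 ≡⟨ count-↭ (adj G v) (↭-trans ρ (prep v π)) ⟨
      count (adj G v) (allFin N)                     <⟨ deg< ⟩
      4 + j                                          ∎)
    ∣zs∣≥ : 5 + j ≤ length zs
    ∣zs∣≥ = +-cancelˡ-≤ (length ys) _ _ (begin
      length ys + (5 + j)     ≤⟨ +-monoˡ-≤ (5 + j) ∣ys∣≤ ⟩
      3 + j + (5 + j)         ≡⟨ total ⟨
      length As + length Bs   ≡⟨ length-++ As ⟨
      length (As ++ Bs)       ≡⟨ cong length As++Bs ⟩
      length (zs ++ ys)       ≡⟨ length-++ zs ⟩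
      length zs + length ys   ≡⟨ +-comm (length zs) (length ys) ⟩
      length ys + length zs   ∎)
    lenA : length As ≡ 5 + j
    lenA = trans (length-take (5 + j) zs) (m≤n⇒m⊓n≡m ∣zs∣≥)
    lenB : length Bs ≡ 3 + j
    lenB = +-cancelʳ-≡ (5 + j) _ _
             (trans (trans (+-comm (length Bs) (5 + j)) (cong (_+ length Bs) (sym lenA))) total)

  path-or-tree : ∀ i {m} → m ≤ 5 + (j + j) →
                 Contains G (Path m) ⊎ Contains (complement G) (T i (8 + j))
  path-or-tree i {m} m≤ with any? (λ v → count (adj G v) (allFin N) <? 4 + j)
  -- The number of vertices is 2d + 1 with d = 4 + j, and `pathAndRest` at one less than that number
  -- yields a Hamiltonian path.
  ... | no ¬low
    with _ , _ , vs , ys , p , σ , len ←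
      pathAndRest G (4 + j) (trans N≡ (doubled j)) (λ x → ≮⇒≥ (λ low → ¬low (x , low)))
        (8 + (j + j)) (≤-reflexive (sym N≡)) =
    inj₁ (walk⇒Path G p (Unique-++⁻ˡ vs (Unique-resp-↭ (↭-sym σ) (allFin⁺ N)))
      (≤-trans m≤ (≤-trans (m≤n+m _ 4) (≤-reflexive (sym len)))))
  ... | yes (v , low) with A , B , σ , lenA , lenB , v≁A ← lowDegree⇒star v low with i
  ...   | Fin.zero         = star⇒T1 G m≤ v A B σ lenA lenB v≁A
  ...   | Fin.suc Fin.zero = star⇒T2 G m≤ v A B σ lenA lenB v≁A

-- The lower bound from two disjoint cliques.

module TwoCliques (c : ℕ) {M : ℕ} (M≤ : M ≤ 2 * c) where

  -- Embedding `Fin M` into `Fin (2 * c)`, read as two blocks of size `c`, treats every `M` up to 2c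
  -- at once.
  side : Fin M → Fin 2
  side u = Fin.quotient c (Fin.inject≤ u M≤)

  position : Fin M → Fin c
  position u = Fin.remainder {2} c (Fin.inject≤ u M≤)

  side-position-injective : ∀ {u v} → side u ≡ side v → position u ≡ position v → u ≡ v
  side-position-injective {u} {v} s p = inject≤-injective M≤ M≤ u v
    (trans (sym (combine-remQuot {2} c _)) (trans (cong₂ Fin.combine s p) (combine-remQuot {2} c _)))

  sameSide : Fin M → Fin M → Bool
  sameSide u v = isYes (side u Fin.≟ side v)

  cliques : Graph M
  cliques = symClose M sameSide

  adjacent⇒side≡ : ∀ u v → adj cliques u v ≡ true → side u ≡ side v
  adjacent⇒side≡ u v e with symClose⁻ sameSide u v e
  ... | inj₁ s = toWitness (Equivalence.from T-≡ s)
  ... | inj₂ s = sym (toWitness (Equivalence.from T-≡ s))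

  nonadjacent⇒side≢ : ∀ u v → adj (complement cliques) u v ≡ true → side u ≢ side v
  nonadjacent⇒side≢ u v e s
    with () ← trans (sym (symClose⁺ sameSide u v (adj⇒≢ (complement cliques) e)
                (Equivalence.to T-≡ (fromWitness s)))) (complement⁻ cliques {u} {v} e)

  -- Distinct vertices on one side have distinct positions in `Fin c`.
  side-bound : ∀ {k} (g : Fin k → Fin M) → (∀ {i i′} → g i ≡ g i′ → i ≡ i′) →
               (∀ i i′ → side (g i) ≡ side (g i′)) → k ≤ c
  side-bound g g-inj same =
    injective⇒≤ {f = position ∘ g} (λ {i} {i′} → g-inj ∘ side-position-injective (same i i′))

  -- Each edge stays within a clique, so the whole path lies on the side of its first vertex.
  path-bound : ∀ {m} → Contains cliques (Path m) → m ≤ c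
  path-bound {zero}  _ = z≤n
  path-bound {suc m} (f , f-inj , hom) = side-bound f f-inj λ i i′ → trans (to-start i) (sym (to-start i′))
    where
    walkBack : ∀ k (k< : k < suc m) → side (f (Fin.fromℕ< k<)) ≡ side (f Fin.zero)
    walkBack zero    (s≤s _) = refl
    walkBack (suc k) k<@(s≤s k<m) = trans
      (sym (adjacent⇒side≡ (f u) (f w) (hom u w (symClose⁺ (λ a b → suc (toℕ a) ≡ᵇ toℕ b) u w
        (λ u≡w → 1+n≢n (trans (sym toℕw) (trans (cong toℕ (sym u≡w)) toℕu)))
        (Equivalence.to T-≡ (≡⇒≡ᵇ (suc (toℕ u)) (toℕ w) (trans (cong suc toℕu) (sym toℕw))))))))
      (walkBack k (m≤n⇒m≤1+n k<m))
      where
      u w : Fin (suc m)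
      u = Fin.fromℕ< (m≤n⇒m≤1+n k<m)
      w = Fin.fromℕ< k<
      toℕu : toℕ u ≡ k
      toℕu = toℕ-fromℕ< _
      toℕw : toℕ w ≡ suc k
      toℕw = toℕ-fromℕ< k<
    to-start : ∀ i → side (f i) ≡ side (f Fin.zero)
    to-start i = subst (λ i → side (f i) ≡ side (f Fin.zero)) (fromℕ<-toℕ i _) (walkBack (toℕ i) (toℕ<n i))

  opposite : ∀ {x y z : Fin 2} → x ≢ y → x ≢ z → y ≡ z
  opposite {y = Fin.zero}         {Fin.zero}         _ _ = refl
  opposite {y = Fin.suc Fin.zero} {Fin.suc Fin.zero} _ _ = refl
  opposite {Fin.zero}         {Fin.zero}         {Fin.suc Fin.zero} x≢y _ = contradiction refl x≢y
  opposite {Fin.suc Fin.zero} {Fin.zero}         {Fin.suc Fin.zero} _ x≢z = contradiction refl x≢z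
  opposite {Fin.zero}         {Fin.suc Fin.zero} {Fin.zero}         _ x≢z = contradiction refl x≢z
  opposite {Fin.suc Fin.zero} {Fin.suc Fin.zero} {Fin.zero}         x≢y _ = contradiction refl x≢y

  -- In the complement every leaf is on the side opposite to the centre; as there are two sides, the
  -- `k` leaves share one.
  star-bound : ∀ {n k p q r s} → k ≤ n →
    Contains (complement cliques)
      (symClose (suc n) (λ a b → treeEdge k p q r s (toℕ a) (toℕ b))) → k ≤ c
  star-bound {n} {k} {p} {q} {r} {s} k≤n (f , f-inj , hom) =
    side-bound (f ∘ leaf) (inject≤-injective k≤n k≤n _ _ ∘ Fin-suc-injective ∘ f-inj)
      λ i i′ → opposite (nonadjacent⇒side≢ (f Fin.zero) _ (spoke i))
                         (nonadjacent⇒side≢ _ _ (spoke i′))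
    where
    leaf : Fin k → Fin (suc n)
    leaf i = Fin.suc (Fin.inject≤ i k≤n)
    spoke : ∀ i → adj (complement cliques) (f Fin.zero) (f (leaf i)) ≡ true
    spoke i = hom Fin.zero (leaf i) (symClose⁺ (λ a b → treeEdge k p q r s (toℕ a) (toℕ b))
      Fin.zero (leaf i) (λ ())
      (Equivalence.to T-≡ (Equivalence.from T-∨ (inj₁ (≤⇒≤ᵇ (subst (_< k) (sym (toℕ-inject≤ i k≤n)) (toℕ<n i)))))))

lowerBound : ∀ {j m M} i → 5 + j ≤ m → M ≤ 2 * (4 + j) → ¬ RamseyProp (Path m) (T i (8 + j)) M
lowerBound {j} i m≥ M≤ ramsey with ramsey (TwoCliques.cliques (4 + j) M≤)
... | inj₁ path = contradiction (TwoCliques.path-bound (4 + j) M≤ path) (<⇒≱ m≥)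
... | inj₂ tree = contradiction (tree-bound i tree) 1+n≰n
  where
  tree-bound : ∀ i → Contains (complement (TwoCliques.cliques (4 + j) M≤)) (T i (8 + j)) → 5 + j ≤ 4 + j
  tree-bound Fin.zero           = TwoCliques.star-bound (4 + j) M≤ (m≤n+m (5 + j) 2)
  tree-bound (Fin.suc Fin.zero) = TwoCliques.star-bound (4 + j) M≤ (m≤n+m (5 + j) 2)

-- The Ramsey number for a range of path lengths, and the theorem.

ramsey-path-tree : ∀ i {j m} → 5 + j ≤ m → m ≤ 5 + (j + j) →
                   RamseyNumberIs (Path m) (T i (8 + j)) (2 * (8 + j) ∸ 7)
-- With n = 8 + j, the range of `m` goes from n - 3, too long for a clique on n - 4 vertices, to 2n
-- - 11, the length of the alternating path.
ramsey-path-tree i {j} m≥ m≤ =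
  ≤-trans (s≤s z≤n) (≤-reflexive (sym N≡)) ,
  (λ G → path-or-tree G N≡ i m≤) ,
  λ M _ M<N → lowerBound i m≥ (s≤s⁻¹ (≤-trans M<N (≤-reflexive (trans N≡ (doubled j)))))
  where
  N≡ : 2 * (8 + j) ∸ 7 ≡ 9 + (j + j)
  N≡ = cong (_∸ 7) (lemma j)
    where
    lemma : ∀ j → 2 * (8 + j) ≡ 16 + (j + j)
    lemma = solve-∀
  doubled : ∀ j → 9 + (j + j) ≡ suc (2 * (4 + j))
  doubled = solve-∀

theorem4p3 : (i : Fin 2) (n : ℕ) → 1 ≤ n →
    (17 ≤ n → RamseyNumberIs (Path n) (T i n) (2 * n ∸ 7)) ×
    (13 ≤ n → RamseyNumberIs (Path (n ∸ 1)) (T i n) (2 * n ∸ 7)) ×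
    (11 ≤ n → RamseyNumberIs (Path (n ∸ 2)) (T i n) (2 * n ∸ 7)) ×
    (8 ≤ n → RamseyNumberIs (Path (n ∸ 3)) (T i n) (2 * n ∸ 7))
theorem4p3 i n _ =
  -- Each `m≤m+n` passes from the stated bound on `n` to `11 ∸ t ≤ n` or to `8 ≤ n`.
  (λ n≥ → ramsey n 0 z≤n (≤-trans (m≤m+n 11 6) n≥) (≤-trans (m≤m+n 8 9) n≥)) ,
  (λ n≥ → ramsey n 1 (s≤s z≤n) (≤-trans (m≤m+n 10 3) n≥) (≤-trans (m≤m+n 8 5) n≥)) ,
  (λ n≥ → ramsey n 2 (s≤s (s≤s z≤n)) (≤-trans (m≤m+n 9 2) n≥) (≤-trans (m≤m+n 8 3) n≥)) ,
  (λ n≥ → ramsey n 3 ≤-refl n≥ n≥)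
  where
  -- The bound `11 ∸ t ≤ n` expresses n - t ≤ 2n - 11, and `t ≤ 3` gives n - 3 ≤ n - t.
  ramsey : ∀ n t → t ≤ 3 → 11 ∸ t ≤ n → 8 ≤ n → RamseyNumberIs (Path (n ∸ t)) (T i n) (2 * n ∸ 7)
  ramsey n t t≤3 n≥ 8≤n with j ← n ∸ 8 | refl ← m+[n∸m]≡n 8≤n =
    ramsey-path-tree i (∸-monoʳ-≤ (8 + j) t≤3) (m≤n+o⇒m∸n≤o (8 + j) t (begin
      3 + (5 + j)       ≤⟨ +-monoˡ-≤ (5 + j) 3≤t+j ⟩
      (t + j) + (5 + j) ≡⟨ lemma₂ t j ⟩
      t + (5 + (j + j)) ∎))
    where
    open ≤-Reasoning
    lemma₁ : ∀ t j → t + (8 + j) ≡ 8 + (t + j)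
    lemma₁ = solve-∀
    3≤t+j : 3 ≤ t + j
    3≤t+j = +-cancelˡ-≤ 8 3 _ (begin
      11           ≤⟨ m≤n+m∸n 11 t ⟩
      t + (11 ∸ t) ≤⟨ +-monoʳ-≤ t n≥ ⟩
      t + (8 + j)  ≡⟨ lemma₁ t j ⟩
      8 + (t + j)  ∎)
    lemma₂ : ∀ t j → (t + j) + (5 + j) ≡ t + (5 + (j + j))
    lemma₂ = solve-∀
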